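{- Let $K$ be a field, $b\ge2$ an integer, and let $M=(m_{i,j})_{i,j\ge0}$ be an infinite matrix over $K$ that is $b$-autosimilar and non-degenerate. Then there is a factorization $M=LDU$ where $L$, $D$, $U$ are $b$-autosimilar infinite matrices, $L$ is unipotent lower-triangular, $D$ is diagonal, and $U$ is unipotent upper-triangular.
   Context: An infinite matrix $M=(m_{i,j})_{i,j\ge0}$ is $b$-autosimilar if $m_{0,0}=1$ and $m_{s,t}=\prod_i m_{\sigma_i,\tau_i}$ whenever $s=\sum_i\sigma_ib^i$, $t=\sum_i\tau_ib^i$ are base-$b$ expansions with $\sigma_i,\tau_i\in\{0,\dots,b-1\}$. $M(n)$ denotes the submatrix $(m_{i,j})_{0\le i,j<n}$. A $b$-autosimilar $M$ is non-degenerate if $\det(M(n))$ is invertible (nonzero) for $n=2,\dots,b$. The product $LDU$ of infinite triangular/diagonal matrices is defined entrywise by finite sums. -}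

module Defs where

open import Algebra.Apartness.Bundles using (HeytingField; HeytingCommutativeRing)
open import Algebra.Bundles using (CommutativeRing; Semiring)
import Algebra.Definitions.RawSemiring as RawSemiringDefinitions
open import Data.Fin.Base using (Fin; zero; suc; toℕ; punchIn)
import Data.Nat.Base as ℕ
open import Data.Nat.Base using (ℕ; zero; suc; _≤_; _<_)
open import Data.Product.Base using (_×_)
open import Relation.Binary.PropositionalEquality.Core using (_≢_)

-- Least significant digit first; leading zeros are allowed.
fromExpansion : (b : ℕ) {k : ℕ} → (Fin k → Fin b) → ℕ
fromExpansion b σ = sum (λ i → toℕ (σ i) ℕ.* b ℕ.^ toℕ i)
  where open RawSemiringDefinitions ℕ.+-*-rawSemiring using (sum)

-- Nonzero is rendered as x # 0#, which in a Heyting field says exactly that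
-- x - 0# has a multiplicative inverse.  No decidability of _≈_ is assumed.
module InfiniteMatrices {c ℓ₁ ℓ₂} (K : HeytingField c ℓ₁ ℓ₂) where

  open HeytingField K hiding (zero)
  open CommutativeRing
    (HeytingCommutativeRing.commutativeRing heytingCommutativeRing)
    using (semiring)
  open RawSemiringDefinitions (Semiring.rawSemiring semiring)
    using (sum; product; _^_)

  Matrix∞ : Set c
  Matrix∞ = ℕ → ℕ → Carrier

  IsAutosimilar : ℕ → Matrix∞ → Set ℓ₁
  IsAutosimilar b M =
    M 0 0 ≈ 1# ×
    (∀ {k} (σ τ : Fin k → Fin b) →
      M (fromExpansion b σ) (fromExpansion b τ)
        ≈ product (λ i → M (toℕ (σ i)) (toℕ (τ i))))

  leading : Matrix∞ → (n : ℕ) → (Fin n → Fin n → Carrier)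
  leading M n i j = M (toℕ i) (toℕ j)

  -- Laplace expansion along the first row.
  det : ∀ {n} → (Fin n → Fin n → Carrier) → Carrier
  det {zero}  A = 1#
  det {suc n} A = sum (λ j →
    (- 1#) ^ toℕ j * (A zero j * det (λ r s → A (suc r) (punchIn j s))))

  IsNonDegenerate : ℕ → Matrix∞ → Set ℓ₂
  IsNonDegenerate b M = ∀ n → 2 ≤ n → n ≤ b → det (leading M n) # 0#

  IsDiagonal : Matrix∞ → Set ℓ₁
  IsDiagonal A = ∀ i j → i ≢ j → A i j ≈ 0#

  IsUnipotentLowerTriangular : Matrix∞ → Set ℓ₁
  IsUnipotentLowerTriangular A =
    (∀ i j → i < j → A i j ≈ 0#) × (∀ i → A i i ≈ 1#)

  IsUnipotentUpperTriangular : Matrix∞ → Set ℓ₁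
  IsUnipotentUpperTriangular A =
    (∀ i j → j < i → A i j ≈ 0#) × (∀ i → A i i ≈ 1#)

  -- The matrix product A B for lower-triangular A: the terms of
  -- Σ_k A i k * B k j with k > i vanish, so the sum runs over k ≤ i.  It is
  -- the true product in (L ⊗ D) ⊗ U, as L and L D are both lower-triangular.
  infixl 7 _⊗_
  _⊗_ : Matrix∞ → Matrix∞ → Matrix∞
  (A ⊗ B) i j = sum {suc i} (λ k → A i (toℕ k) * B (toℕ k) j)

  infix 4 _≈∞_
  _≈∞_ : Matrix∞ → Matrix∞ → Set ℓ₁
  A ≈∞ B = ∀ i j → A i j ≈ B i j

{-# OPTIONS --safe #-}

-- The b × b digit block of M has invertible leading minors, so it has an LDU factorization, found by
-- eliminating the first row and column: the leading minors of the Schur complement are those of the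
-- block divided by the corner entry.  The factors extend uniquely from digits to autosimilar matrices,
-- and this extension commutes with products of lower-triangular by arbitrary matrices, because a sum
-- over k = r + q b factors into a sum over the last digit r and a sum over q.  An autosimilar matrix is
-- determined by its digit block, hence M is the product of the extended factors.
module Submission where

open import Algebra.Apartness.Bundles using (HeytingField; HeytingCommutativeRing)
open import Algebra.Bundles using (CommutativeRing; Semiring)
import Algebra.Apartness.Properties.HeytingCommutativeRing as HeytingProperties
import Algebra.Definitions.RawSemiring as RawSemiringDefinitions
open import Algebra.Properties.CommutativeSemigroup using (x∙yz≈y∙xz)
import Algebra.Properties.Ring as RingProperties
import Algebra.Properties.Semiring.Sum as SemiringSum
import Algebra.Solver.Ring.NaturalCoefficients.Default as SemiringSolver
open import Data.Fin.Base using (Fin; zero; suc; toℕ; fromℕ<; punchIn; pinch)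
import Data.Fin.Properties as Fin
open import Data.Nat.Base as ℕ
  using (ℕ; zero; suc; _≤_; _<_; z≤n; s≤s; _%_; _/_; _⊔_; NonZero; NonTrivial)
open import Data.Nat.Divisibility using (n∣m*n)
open import Data.Nat.DivMod
  using ( DivMod; _divMod_; _mod_; 0/n≡0; m/n<m; m*n/n≡m; m<n⇒m/n≡0; m<n⇒m%n≡m
        ; [m+kn]%n≡m%n; +-distrib-/-∣ʳ )
import Data.Nat.Properties as ℕ
open import Data.Product.Base using (_×_; _,_; ∃-syntax)
open import Data.Sum.Base using (_⊎_; inj₁; inj₂)
open import Data.Vec.Functional using (_∷_)
open import Function.Base using (_∘_)
open import Relation.Binary.Core using (Rel)
open import Relation.Binary.PropositionalEquality.Core as ≡ using (_≡_; _≢_)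
import Relation.Binary.Reasoning.Setoid as SetoidReasoning
open import Relation.Nullary.Decidable using (yes; no)
open import Relation.Nullary.Negation using (¬_; contradiction)
open import Defs

-- Removing two indices in either order

-- With `l = punchIn k j`, the index `pinch j k` is the position of `k` once `l` has been removed.
-- Hence `(l , pinch j k)` encodes the ordered pair opposite to the one encoded by `(k , j)`.
punchIn-pinch : ∀ {n} (k : Fin (suc n)) (j : Fin n) →
  punchIn (punchIn k j) (pinch j k) ≡ k
punchIn-pinch {suc n} zero    j       = ≡.refl
punchIn-pinch {suc n} (suc k) zero    = ≡.refl
punchIn-pinch {suc n} (suc k) (suc j) = ≡.cong suc (punchIn-pinch k j)

-- Both sides enumerate in increasing order the indices other than `k` and `punchIn k j`.
punchIn-punchIn : ∀ {n} (k : Fin (suc (suc n))) (j : Fin (suc n)) (s : Fin n) →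
  punchIn (punchIn k j) (punchIn (pinch j k) s) ≡ punchIn k (punchIn j s)
punchIn-punchIn zero    j       s       = ≡.refl
punchIn-punchIn (suc k) zero    s       = ≡.refl
punchIn-punchIn (suc k) (suc j) zero    = ≡.refl
punchIn-punchIn (suc k) (suc j) (suc s) = ≡.cong suc (punchIn-punchIn k j s)

module Factorization {c ℓ₁ ℓ₂} (K : HeytingField c ℓ₁ ℓ₂) where

  open InfiniteMatrices K
  open HeytingField K using (_#_; heytingCommutativeRing; #⇒invertible)
  open CommutativeRing (HeytingCommutativeRing.commutativeRing heytingCommutativeRing) hiding (zero)
  open HeytingProperties heytingCommutativeRing using (x-0≈x; invertibleʳ⇒#; #-congʳ; 1#0)
  open RingProperties ring using (-‿distribˡ-*; -‿involutive)
  open RawSemiringDefinitions (Semiring.rawSemiring semiring) using (product; _^_)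
  open SemiringSum semiring
    using (sum; sum-cong-≋; sum-replicate-zero; ∑-distrib-+; *-distribˡ-sum; *-distribʳ-sum)
  open SetoidReasoning setoid
  open SemiringSolver commutativeSemiring using (solve; _:=_; _:+_; _:*_; con)

  -- Determinants under a rank-one perturbation

  sum-≈0 : ∀ {n} (f : Fin n → Carrier) → (∀ i → f i ≈ 0#) → sum f ≈ 0#
  sum-≈0 {n} f f≈0 = trans (sum-cong-≋ f≈0) (sum-replicate-zero n)

  Matrix : ℕ → Set c
  Matrix n = Fin n → Fin n → Carrier

  det-cong : ∀ {n} {A B : Matrix n} → (∀ i j → A i j ≈ B i j) → det A ≈ det B
  det-cong {zero}  A≈B = refl
  det-cong {suc n} A≈B = sum-cong-≋ {suc n} λ j → *-congˡ {(- 1#) ^ toℕ j}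
    (*-cong (A≈B zero j) (det-cong λ r s → A≈B (suc r) (punchIn j s)))

  -- (k , j) stands for the ordered pair of distinct indices (k , punchIn k j); the hypothesis relates it
  -- to the opposite pair.  Cancelling pair by pair avoids a division by 2.
  sum-alternating : ∀ {n} (t : Fin (suc n) → Fin n → Carrier) →
    (∀ k j → t k j + t (punchIn k j) (pinch j k) ≈ 0#) →
    sum (λ k → sum (t k)) ≈ 0#
  sum-alternating {zero}  t alt = +-identityʳ 0#
  sum-alternating {suc n} t alt = begin
    -- The pairs that contain the index 0 are `(zero , j)` and `(suc j , zero)`, which are opposite.
    -- The other pairs form the same sum with one index fewer.
    sum (t zero) + sum (λ k → t (suc k) zero + sum (t (suc k) ∘ suc))
      ≈⟨ +-congˡ (∑-distrib-+ (λ k → t (suc k) zero) (λ k → sum (t (suc k) ∘ suc))) ⟩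
    sum (t zero) + (sum (λ k → t (suc k) zero) + rest)
      ≈⟨ +-assoc _ _ _ ⟨
    sum (t zero) + sum (λ k → t (suc k) zero) + rest
      ≈⟨ +-cong (sym (∑-distrib-+ (t zero) (λ k → t (suc k) zero)))
           (sum-alternating (λ k j → t (suc k) (suc j)) (λ k j → alt (suc k) (suc j))) ⟩
    sum (λ j → t zero j + t (suc j) zero) + 0#
      ≈⟨ +-congʳ (sum-≈0 _ (alt zero)) ⟩
    0# + 0#
      ≈⟨ +-identityʳ 0# ⟩
    0# ∎
    where rest = sum (λ k → sum (t (suc k) ∘ suc))

  ε : ∀ {n} → Fin n → Carrier
  ε j = (- 1#) ^ toℕ j

  -1*-1≈1 : - 1# * - 1# ≈ 1#
  -1*-1≈1 = trans (sym (-‿distribˡ-* 1# (- 1#)))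
    (trans (-‿cong (*-identityˡ (- 1#))) (-‿involutive 1#))

  x+-1*x≈0 : ∀ x → x + - 1# * x ≈ 0#
  x+-1*x≈0 x = begin
    x + - 1# * x       ≈⟨ solve 2 (λ x m → x :+ m :* x := (con 1 :+ m) :* x) refl x (- 1#) ⟩
    (1# + - 1#) * x    ≈⟨ *-congʳ (-‿inverseʳ 1#) ⟩
    0# * x             ≈⟨ zeroˡ x ⟩
    0#                 ∎

  -- Of two indices, the larger drops by one exactly when the smaller is removed first. So the sign
  -- exponents for the two orders of removal differ by one.
  ε-swap : ∀ {n} (k : Fin (suc n)) (j : Fin n) →
    ε (punchIn k j) * ε (pinch j k) ≈ - 1# * (ε k * ε j)
  ε-swap {suc n} zero    j = solve 2 (λ m x → m :* x :* con 1 := m :* (con 1 :* x)) refl (- 1#) (ε j)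
  ε-swap {suc n} (suc k) zero = begin
    1# * ε k
      ≈⟨ *-congʳ (sym -1*-1≈1) ⟩
    (- 1# * - 1#) * ε k
      ≈⟨ solve 2 (λ m x → m :* m :* x := m :* (m :* x :* con 1)) refl (- 1#) (ε k) ⟩
    - 1# * (- 1# * ε k * 1#) ∎
  ε-swap {suc n} (suc k) (suc j) = begin
    (m * ε (punchIn k j)) * (m * ε (pinch j k))
      ≈⟨ solve 3 (λ m x y → (m :* x) :* (m :* y) := m :* (m :* (x :* y))) refl m _ _ ⟩
    m * (m * (ε (punchIn k j) * ε (pinch j k)))
      ≈⟨ *-congˡ (*-congˡ (ε-swap k j)) ⟩
    m * (m * (m * (ε k * ε j)))
      ≈⟨ solve 3 (λ m x y → m :* (m :* (m :* (x :* y))) := m :* ((m :* x) :* (m :* y))) refl m _ _ ⟩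
    m * ((m * ε k) * (m * ε j)) ∎
    where m = - 1#

  infixr 5 _◂_
  _◂_ : ∀ {m n} → (Fin m → Carrier) → (Fin m → Fin n → Carrier) → Fin m → Fin (suc n) → Carrier
  (v ◂ B) r zero    = v r
  (v ◂ B) r (suc s) = B r s

  -- The columns of B with the j-th one removed, preceded by v.
  exchange : ∀ {n} → (Fin n → Carrier) → Matrix n → Fin n → Matrix n
  exchange v B j r s = (v ◂ B) r (punchIn (suc j) s)

  -- Expanding both sides along the first row, the difference is a sum over ordered pairs of distinct
  -- columns whose terms t are antisymmetric.
  det-rankOne : ∀ {n} (B : Matrix n) (v w : Fin n → Carrier) →
    det (λ r s → B r s + v r * w s)
      ≈ det B + sum (λ j → ε j * (w j * det (exchange v B j)))
  det-rankOne {zero}  B v w = sym (+-identityʳ 1#)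
  det-rankOne {suc n} B v w = begin
    sum (λ k → ε k * ((B₀ k + v₀ * w k) * det (λ r s → B⁻ k r s + v (suc r) * w (punchIn k s))))
      ≈⟨ sum-cong-≋ expand ⟩
    sum (λ k → P k + Q k + sum (t k))
      ≈⟨ ∑-distrib-+ (λ k → P k + Q k) (λ k → sum (t k)) ⟩
    sum (λ k → P k + Q k) + sum (λ k → sum (t k))
      ≈⟨ +-cong (∑-distrib-+ P Q) (sum-alternating t t-alt) ⟩
    sum P + sum Q + 0#
      ≈⟨ +-identityʳ _ ⟩
    det B + sum (λ j → ε j * (w j * det (exchange v B j))) ∎
    where
    v₀ = v zero
    B₀ = B zero
    B⁻ : Fin (suc n) → Matrix n
    B⁻ k r s = B (suc r) (punchIn k s)

    -- Below the first row, this minor keeps the column `v` and drops the columns `k` and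
    -- `punchIn k j` of `B`. It depends only on the unordered pair of dropped columns, which is
    -- `D-swap`.
    D : Fin (suc n) → Fin n → Carrier
    D k j = det (λ r s → (v ◂ B) (suc r) (punchIn (suc k) (punchIn (suc j) s)))

    D-swap : ∀ k j → D (punchIn k j) (pinch j k) ≈ D k j
    D-swap k j@zero    = det-cong λ r s →
      reflexive (≡.cong ((v ◂ B) (suc r)) (punchIn-punchIn (suc k) (suc j) s))
    D-swap k j@(suc _) = det-cong λ r s →
      reflexive (≡.cong ((v ◂ B) (suc r)) (punchIn-punchIn (suc k) (suc j) s))

    exchange-minor : ∀ k j → det (exchange (v ∘ suc) (B⁻ k) j) ≈ D k j
    exchange-minor k j = det-cong {n} λ where
      r zero    → refl
      r (suc s) → refl

    -- Symmetric in `k` and `l`, since a swap exchanges the two outer terms. As `D` is symmetric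
    -- too, the sign from `ε-swap` makes `t` antisymmetric.
    S : Fin (suc n) → Fin (suc n) → Carrier
    S k l = B₀ k * w l + v₀ * (w k * w l) + w k * B₀ l

    t : Fin (suc n) → Fin n → Carrier
    t k j = ε k * ε j * (D k j * S k (punchIn k j))

    t-alt : ∀ k j → t k j + t (punchIn k j) (pinch j k) ≈ 0#
    t-alt k j = begin
      t k j + ε l * ε (pinch j k) * (D l (pinch j k) * S l (punchIn l (pinch j k)))
        ≈⟨ +-congˡ (*-cong (ε-swap k j) (*-cong (D-swap k j) (reflexive (≡.cong (S l) (punchIn-pinch k j))))) ⟩
      t k j + - 1# * (ε k * ε j) * (D k j * S l k)
        ≈⟨ +-congˡ (solve 8
             (λ m e D v Bk Bl wk wl →
               m :* e :* (D :* (Bl :* wk :+ v :* (wl :* wk) :+ wl :* Bk))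
               := m :* (e :* (D :* (Bk :* wl :+ v :* (wk :* wl) :+ wk :* Bl))))
             refl (- 1#) (ε k * ε j) (D k j) v₀ (B₀ k) (B₀ l) (w k) (w l)) ⟩
      t k j + - 1# * t k j
        ≈⟨ x+-1*x≈0 (t k j) ⟩
      0# ∎
      where l = punchIn k j

    P Q : Fin (suc n) → Carrier
    P k = ε k * (B₀ k * det (B⁻ k))
    -- The `k`-th term of the exchange sum, with `det (exchange v B k)` expanded along its first
    -- row: `v₀` comes first and shifts the sign of every later entry.
    Q k = ε k * (w k * (1# * (v₀ * det (B⁻ k)) + sum (λ j → (- 1# * ε j) * (B₀ (punchIn k j) * D k j))))

    expand : ∀ k →
      ε k * ((B₀ k + v₀ * w k) * det (λ r s → B⁻ k r s + v (suc r) * w (punchIn k s)))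
      ≈ P k + Q k + sum (t k)
    expand k = begin
      ε k * ((B₀ k + v₀ * w k) * det (λ r s → B⁻ k r s + v (suc r) * w (punchIn k s)))
        ≈⟨ *-congˡ (*-congˡ (trans (det-rankOne (B⁻ k) (v ∘ suc) (w ∘ punchIn k))
             (+-congˡ (sum-cong-≋ {n} λ j → *-congˡ {ε j} (*-congˡ {w (punchIn k j)} (exchange-minor k j)))))) ⟩
      ε k * ((B₀ k + v₀ * w k) * (det (B⁻ k) + X))
        ≈⟨ +-identityʳ _ ⟨
      ε k * ((B₀ k + v₀ * w k) * (det (B⁻ k) + X)) + 0#
        -- The semiring solver treats `- 1#` as an atom, so a cancelling pair is inserted by hand.
        -- Its negative half completes `Q k`, its positive half completes `sum (t k)`.
        ≈⟨ +-congˡ (x+-1*x≈0 (ε k * (w k * Y))) ⟨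
      ε k * ((B₀ k + v₀ * w k) * (det (B⁻ k) + X)) + (ε k * (w k * Y) + - 1# * (ε k * (w k * Y)))
        ≈⟨ solve 8 (λ e b v w d x y m →
              e :* ((b :+ v :* w) :* (d :+ x)) :+ (e :* (w :* y) :+ m :* (e :* (w :* y)))
              := (e :* (b :* d) :+ e :* (w :* (con 1 :* (v :* d) :+ m :* y)))
                 :+ (e :* ((b :+ v :* w) :* x) :+ e :* (w :* y)))
             refl (ε k) (B₀ k) v₀ (w k) (det (B⁻ k)) X Y (- 1#) ⟩
      (ε k * (B₀ k * det (B⁻ k)) + ε k * (w k * (1# * (v₀ * det (B⁻ k)) + - 1# * Y)))
         + (ε k * ((B₀ k + v₀ * w k) * X) + ε k * (w k * Y))
        ≈⟨ +-cong
             (+-congˡ (*-congˡ (*-congˡ (+-congˡ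
               (trans (*-distribˡ-sum (- 1#) (λ j → ε j * (B₀ (punchIn k j) * D k j)))
                 (sum-cong-≋ {n} λ j → sym (*-assoc (- 1#) (ε j) (B₀ (punchIn k j) * D k j))))))))
             (sym t-sum) ⟩
      _ ∎
      where
      X = sum (λ j → ε j * (w (punchIn k j) * D k j))
      Y = sum (λ j → ε j * (B₀ (punchIn k j) * D k j))
      t-sum : sum (t k) ≈ ε k * ((B₀ k + v₀ * w k) * X) + ε k * (w k * Y)
      t-sum = begin
        sum (t k)
          ≈⟨ (sum-cong-≋ λ j → solve 8
               (λ e e′ D b v w wl bl →
                  e :* e′ :* (D :* (b :* wl :+ v :* (w :* wl) :+ w :* bl))
                  := e :* (b :+ v :* w) :* (e′ :* (wl :* D)) :+ e :* w :* (e′ :* (bl :* D)))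
               refl (ε k) (ε j) (D k j) (B₀ k) v₀ (w k) (w (punchIn k j)) (B₀ (punchIn k j))) ⟩
        sum (λ j → ε k * (B₀ k + v₀ * w k) * (ε j * (w (punchIn k j) * D k j))
                   + ε k * w k * (ε j * (B₀ (punchIn k j) * D k j)))
          ≈⟨ ∑-distrib-+ (λ j → ε k * (B₀ k + v₀ * w k) * (ε j * (w (punchIn k j) * D k j)))
                (λ j → ε k * w k * (ε j * (B₀ (punchIn k j) * D k j))) ⟩
        sum (λ j → ε k * (B₀ k + v₀ * w k) * (ε j * (w (punchIn k j) * D k j)))
          + sum (λ j → ε k * w k * (ε j * (B₀ (punchIn k j) * D k j)))
          ≈⟨ +-cong (*-distribˡ-sum _ (λ j → ε j * (w (punchIn k j) * D k j)))
                    (*-distribˡ-sum _ (λ j → ε j * (B₀ (punchIn k j) * D k j))) ⟨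
        ε k * (B₀ k + v₀ * w k) * X + ε k * w k * Y
          ≈⟨ +-cong (*-assoc _ _ _) (*-assoc _ _ _) ⟩
        ε k * ((B₀ k + v₀ * w k) * X) + ε k * (w k * Y) ∎

  -- Elimination of the corner entry

  -- The Schur complement of the corner entry, whose inverse is q.
  schur : Carrier → Matrix∞ → Matrix∞
  schur q A i j = A (suc i) (suc j) + A (suc i) 0 * (- 1# * (q * A 0 (suc j)))

  -- `schur q A` is a rank-one perturbation of the lower right block, so `det-rankOne` applies.
  -- Multiplied by the pivot it gives the expansion along the first row of `A`: the pivot cancels
  -- `q`, and the minus sign in `schur` is the sign by which the cofactors of columns `suc j` and
  -- `j` differ.
  det-schur : ∀ {q} (A : Matrix∞) → A 0 0 * q ≈ 1# → ∀ n →
    det (leading A (suc n)) ≈ A 0 0 * det (leading (schur q A) n)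
  det-schur {q} A pq≈1 n = begin
    1# * (p * det B) + sum (λ j → (- 1# * ε j) * (w j * det (λ r s → A′ (suc r) (punchIn (suc j) s))))
      ≈⟨ +-cong (*-identityˡ _) (sum-cong-≋ term) ⟩
    p * det B + sum (λ j → p * (ε j * ((- 1# * (q * w j)) * det (exchange v B j))))
      ≈⟨ +-congˡ (*-distribˡ-sum p (λ j → ε j * ((- 1# * (q * w j)) * det (exchange v B j)))) ⟨
    p * det B + p * sum (λ j → ε j * ((- 1# * (q * w j)) * det (exchange v B j)))
      ≈⟨ distribˡ p _ _ ⟨
    p * (det B + sum (λ j → ε j * ((- 1# * (q * w j)) * det (exchange v B j))))
      ≈⟨ *-congˡ (det-rankOne B v (λ j → - 1# * (q * w j))) ⟨
    p * det (leading (schur q A) n) ∎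
    where
    p = A 0 0
    A′ = leading A (suc n)
    v w : Fin n → Carrier
    v r = A′ (suc r) zero
    w s = A′ zero (suc s)
    B : Matrix n
    B r s = A′ (suc r) (suc s)

    ◂-split : ∀ r s → A′ (suc r) s ≈ (v ◂ B) r s
    ◂-split r zero    = refl
    ◂-split r (suc s) = refl

    term : ∀ j → (- 1# * ε j) * (w j * det (λ r s → A′ (suc r) (punchIn (suc j) s)))
      ≈ p * (ε j * ((- 1# * (q * w j)) * det (exchange v B j)))
    term j = begin
      (- 1# * ε j) * (w j * det (λ r s → A′ (suc r) (punchIn (suc j) s)))
        ≈⟨ *-congˡ (*-congˡ (det-cong λ r s → ◂-split r (punchIn (suc j) s))) ⟩
      (- 1# * ε j) * (w j * E)
        ≈⟨ *-identityˡ _ ⟨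
      1# * ((- 1# * ε j) * (w j * E))
        ≈⟨ *-congʳ pq≈1 ⟨
      p * q * ((- 1# * ε j) * (w j * E))
        ≈⟨ solve 6 (λ p q m e w d → p :* q :* ((m :* e) :* (w :* d)) := p :* (e :* ((m :* (q :* w)) :* d)))
             refl p q (- 1#) (ε j) (w j) E ⟩
      p * (ε j * ((- 1# * (q * w j)) * E)) ∎
      where E = det (exchange v B j)

  -- If `z` inverts `x * y`, then `x * z` inverts `y`. This passes invertibility from the minors of
  -- a matrix to those of its Schur complement.
  #0-cancelˡ : ∀ {x y} → x * y # 0# → y # 0#
  #0-cancelˡ {x} {y} xy#0 with z , _ , xyz≈1 ← #⇒invertible xy#0 =
    invertibleʳ⇒# (x * z , (begin
      (y - 0#) * (x * z)    ≈⟨ *-congʳ (x-0≈x y) ⟩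
      y * (x * z)           ≈⟨ solve 3 (λ x y z → y :* (x :* z) := x :* y :* z) refl x y z ⟩
      x * y * z             ≈⟨ *-congʳ (x-0≈x (x * y)) ⟨
      (x * y - 0#) * z      ≈⟨ xyz≈1 ⟩
      1#                    ∎))

  -- LDU factorization of a leading block

  border : Carrier → (ℕ → Carrier) → (ℕ → Carrier) → Matrix∞ → Matrix∞
  border p r c B zero    zero    = p
  border p r c B zero    (suc j) = r j
  border p r c B (suc i) zero    = c i
  border p r c B (suc i) (suc j) = B i j

  identity : Matrix∞
  identity zero    zero    = 1#
  identity zero    (suc j) = 0#
  identity (suc i) zero    = 0#
  identity (suc i) (suc j) = identity i j

  identity-diagonal : IsDiagonal identity
  identity-diagonal zero    zero    0≢0 = contradiction ≡.refl 0≢0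
  identity-diagonal zero    (suc j) _   = refl
  identity-diagonal (suc i) zero    _   = refl
  identity-diagonal (suc i) (suc j) i≢j = identity-diagonal i j (i≢j ∘ ≡.cong suc)

  identity-unit : ∀ i → identity i i ≈ 1#
  identity-unit zero    = refl
  identity-unit (suc i) = identity-unit i

  border-unipotentLower : ∀ {c B} → IsUnipotentLowerTriangular B →
    IsUnipotentLowerTriangular (border 1# (λ _ → 0#) c B)
  border-unipotentLower {c} {B} (B-lower , B-unit) = lower , unit
    where
    lower : ∀ i j → i < j → border 1# (λ _ → 0#) c B i j ≈ 0#
    lower zero    (suc j) _         = refl
    lower (suc i) (suc j) (s≤s i<j) = B-lower i j i<j
    unit : ∀ i → border 1# (λ _ → 0#) c B i i ≈ 1#
    unit zero    = refl
    unit (suc i) = B-unit i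

  border-unipotentUpper : ∀ {r B} → IsUnipotentUpperTriangular B →
    IsUnipotentUpperTriangular (border 1# r (λ _ → 0#) B)
  border-unipotentUpper {r} {B} (B-upper , B-unit) = upper , unit
    where
    upper : ∀ i j → j < i → border 1# r (λ _ → 0#) B i j ≈ 0#
    upper (suc i) zero    _         = refl
    upper (suc i) (suc j) (s≤s j<i) = B-upper i j j<i
    unit : ∀ i → border 1# r (λ _ → 0#) B i i ≈ 1#
    unit zero    = refl
    unit (suc i) = B-unit i

  border-diagonal : ∀ {p B} → IsDiagonal B → IsDiagonal (border p (λ _ → 0#) (λ _ → 0#) B)
  border-diagonal B-diag zero    zero    0≢0 = contradiction ≡.refl 0≢0
  border-diagonal B-diag zero    (suc j) _   = refl
  border-diagonal B-diag (suc i) zero    _   = refl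
  border-diagonal B-diag (suc i) (suc j) i≢j = B-diag i j (i≢j ∘ ≡.cong suc)

  #0⇒inverse : ∀ {x} → x # 0# → ∃[ y ] x * y ≈ 1#
  #0⇒inverse {x} x#0 with y , _ , x-0*y≈1 ← #⇒invertible x#0 =
    y , trans (*-congʳ (sym (x-0≈x x))) x-0*y≈1

  det-leading₁ : ∀ A → det (leading A 1) ≈ A 0 0
  det-leading₁ A = solve 1 (λ p → con 1 :* (p :* con 1) :+ con 0 := p) refl (A 0 0)

  -- One elimination step read backwards: factors for the Schur complement are bordered by the
  -- pivot, the first column divided by it and the first row divided by it.
  module Bordered (A : Matrix∞) {q} (pq≈1 : A 0 0 * q ≈ 1#) (L D U : Matrix∞) where

    p = A 0 0
    row col : ℕ → Carrier
    row j = A 0 (suc j)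
    col i = A (suc i) 0
    L⁺ = border 1# (λ _ → 0#) (λ i → col i * q) L
    D⁺ = border p (λ _ → 0#) (λ _ → 0#) D
    U⁺ = border 1# (λ j → q * row j) (λ _ → 0#) U

    first-column : ∀ i → (L⁺ ⊗ D⁺) (suc i) 0 ≈ col i
    first-column i = begin
      col i * q * p + sum {suc i} (λ k → L i (toℕ k) * 0#)
        ≈⟨ +-congˡ (sum-≈0 {suc i} (λ k → L i (toℕ k) * 0#) (λ k → zeroʳ (L i (toℕ k)))) ⟩
      col i * q * p + 0#
        ≈⟨ solve 3 (λ c p q → c :* q :* p :+ con 0 := c :* (p :* q)) refl (col i) p q ⟩
      col i * (p * q)
        ≈⟨ trans (*-congˡ pq≈1) (*-identityʳ (col i)) ⟩
      col i ∎

    lower-right : ∀ i k → (L⁺ ⊗ D⁺) (suc i) (suc k) ≈ (L ⊗ D) i k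
    lower-right i k = trans (+-congʳ (zeroʳ (col i * q))) (+-identityˡ ((L ⊗ D) i k))

    -- Block multiplication: the lower right block of the bordered product is `col i * (q * row j)`
    -- plus `L ⊗ D ⊗ U`, and `schur` subtracts exactly this rank-one term from `A`.
    ⊗-bordered : ∀ {n} → (∀ {i j} → i < n → j < n → schur q A i j ≈ (L ⊗ D ⊗ U) i j) →
      ∀ {i j} → i < suc n → j < suc n → A i j ≈ (L⁺ ⊗ D⁺ ⊗ U⁺) i j
    ⊗-bordered _ {zero}  {zero}  _ _ = solve 1 (λ p → p := (con 1 :* p :+ con 0) :* con 1 :+ con 0) refl p
    ⊗-bordered _ {zero}  {suc j} _ _ = begin
      row j
        ≈⟨ *-identityˡ (row j) ⟨
      1# * row j
        ≈⟨ *-congʳ pq≈1 ⟨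
      p * q * row j
        ≈⟨ solve 3 (λ p q r → p :* q :* r := (con 1 :* p :+ con 0) :* (q :* r) :+ con 0) refl p q (row j) ⟩
      (1# * p + 0#) * (q * row j) + 0# ∎
    ⊗-bordered _ {suc i} {zero}  _ _ = begin
      col i
        ≈⟨ trans (+-identityʳ _) (*-identityʳ (col i)) ⟨
      col i * 1# + 0#
        ≈⟨ +-cong (*-congʳ (first-column i))
             (sum-≈0 {suc i} (λ k → LD⁺ (suc (toℕ k)) * 0#) (λ k → zeroʳ (LD⁺ (suc (toℕ k))))) ⟨
      (L⁺ ⊗ D⁺ ⊗ U⁺) (suc i) 0 ∎
      where LD⁺ = (L⁺ ⊗ D⁺) (suc i)
    ⊗-bordered S≈LDU {suc i} {suc j} (s≤s i<n) (s≤s j<n) = begin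
      A (suc i) (suc j)
        ≈⟨ +-identityʳ _ ⟨
      A (suc i) (suc j) + 0#
        ≈⟨ +-congˡ (x+-1*x≈0 (col i * (q * row j))) ⟨
      A (suc i) (suc j) + (col i * (q * row j) + - 1# * (col i * (q * row j)))
        ≈⟨ solve 4 (λ a c x m → a :+ (c :* x :+ m :* (c :* x)) := c :* x :+ (a :+ c :* (m :* x)))
             refl (A (suc i) (suc j)) (col i) (q * row j) (- 1#) ⟩
      col i * (q * row j) + schur q A i j
        ≈⟨ +-cong (*-congʳ (sym (first-column i))) (S≈LDU i<n j<n) ⟩
      (L⁺ ⊗ D⁺) (suc i) 0 * (q * row j) + (L ⊗ D ⊗ U) i j
        ≈⟨ +-congˡ (sum-cong-≋ {suc i} λ k → *-congʳ {U (toℕ k) j} (lower-right i (toℕ k))) ⟨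
      (L⁺ ⊗ D⁺ ⊗ U⁺) (suc i) (suc j) ∎

  -- The minor of size 1 supplies the pivot, and the minor of size `m + 2` is the pivot times the
  -- complement's minor of size `m + 1`. The factors have their shapes on all indices, while the
  -- product is controlled only on the leading block.
  leading-LDU : ∀ n (A : Matrix∞) → (∀ m → m < n → det (leading A (suc m)) # 0#) →
    ∃[ L ] ∃[ D ] ∃[ U ]
      ( (∀ {i j} → i < n → j < n → A i j ≈ (L ⊗ D ⊗ U) i j)
      × IsUnipotentLowerTriangular L × IsDiagonal D × IsUnipotentUpperTriangular U )
  leading-LDU zero A _ =
    identity , identity , identity , (λ ()) ,
    ((λ i j i<j → identity-diagonal i j (ℕ.<⇒≢ i<j)) , identity-unit) ,
    identity-diagonal ,
    ((λ i j j<i → identity-diagonal i j (ℕ.<⇒≢ j<i ∘ ≡.sym)) , identity-unit)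
  leading-LDU (suc n) A minors#0 =
    let q , pq≈1 = #0⇒inverse (#-congʳ (det-leading₁ A) (minors#0 0 (s≤s z≤n)))
        L , D , U , S≈LDU , L-lower , D-diagonal , U-upper =
          leading-LDU n (schur q A) λ m m<n →
            #0-cancelˡ (#-congʳ (det-schur A pq≈1 (suc m)) (minors#0 (suc m) (s≤s m<n)))
        open Bordered A pq≈1 L D U
    in L⁺ , D⁺ , U⁺ , ⊗-bordered S≈LDU ,
       border-unipotentLower L-lower , border-diagonal D-diagonal , border-unipotentUpper U-upper

  -- Sums over initial segments and their division into blocks

  Σ[0,_⟩ : ∀ n → (ℕ → Carrier) → Carrier
  Σ[0, n ⟩ f = sum {n} (f ∘ toℕ)

  Σ-pad : ∀ {m n} (f : ℕ → Carrier) → m ≤ n → (∀ k → m ≤ k → f k ≈ 0#) →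
    Σ[0, m ⟩ f ≈ Σ[0, n ⟩ f
  Σ-pad {n = n} f z≤n f≈0 = sym (sum-≈0 {n} _ (λ k → f≈0 (toℕ k) z≤n))
  Σ-pad f (s≤s m≤n) f≈0 = +-congˡ (Σ-pad (f ∘ suc) m≤n (λ k m≤k → f≈0 (suc k) (s≤s m≤k)))

  Σ-split : ∀ m {n} (f : ℕ → Carrier) →
    Σ[0, m ℕ.+ n ⟩ f ≈ Σ[0, m ⟩ f + Σ[0, n ⟩ (λ k → f (m ℕ.+ k))
  Σ-split zero    f = sym (+-identityˡ _)
  Σ-split (suc m) f = trans (+-congˡ (Σ-split m (f ∘ suc))) (sym (+-assoc _ _ _))

  Σ-cong : ∀ n {f g : ℕ → Carrier} → (∀ k → f k ≈ g k) → Σ[0, n ⟩ f ≈ Σ[0, n ⟩ g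
  Σ-cong n f≈g = sum-cong-≋ {n} (λ k → f≈g (toℕ k))

  Σ-blocks : ∀ q b (f : ℕ → Carrier) →
    Σ[0, q ℕ.* b ⟩ f ≈ Σ[0, q ⟩ (λ m → Σ[0, b ⟩ (λ r → f (r ℕ.+ m ℕ.* b)))
  Σ-blocks zero    b f = refl
  Σ-blocks (suc q) b f = begin
    Σ[0, b ℕ.+ q ℕ.* b ⟩ f
      ≈⟨ Σ-split b f ⟩
    Σ[0, b ⟩ f + Σ[0, q ℕ.* b ⟩ (λ k → f (b ℕ.+ k))
      ≈⟨ +-cong (Σ-cong b (λ r → reflexive (≡.cong f (≡.sym (ℕ.+-identityʳ r)))))
           (Σ-blocks q b (λ k → f (b ℕ.+ k))) ⟩
    Σ[0, b ⟩ (λ r → f (r ℕ.+ 0)) + Σ[0, q ⟩ (λ m → Σ[0, b ⟩ (λ r → f (b ℕ.+ (r ℕ.+ m ℕ.* b))))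
      ≈⟨ +-congˡ (Σ-cong q λ m → Σ-cong b λ r →
           reflexive (≡.cong f (x∙yz≈y∙xz ℕ.+-commutativeSemigroup b r (m ℕ.* b)))) ⟩
    Σ[0, b ⟩ (λ r → f (r ℕ.+ 0)) + Σ[0, q ⟩ (λ m → Σ[0, b ⟩ (λ r → f (r ℕ.+ (b ℕ.+ m ℕ.* b)))) ∎

  -- Induction on base-`b` digits

  module Base (b : ℕ) .{{_ : NonTrivial b}} where

    instance
      b≢0 : NonZero b
      b≢0 = ℕ.nonTrivial⇒nonZero b

    -- As `b` is at least 2, division by `b` strictly lowers a positive number. So a bound on a
    -- number also bounds how often a last digit can be stripped before 0 is reached.
    m/b≤ : ∀ {m n} → m ≤ suc n → m / b ≤ n
    m/b≤ {zero}  _   = ℕ.≤-trans (ℕ.≤-reflexive (0/n≡0 b)) z≤n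
    m/b≤ {suc m} m≤n = ℕ.≤-pred (ℕ.<-≤-trans (m/n<m (suc m) b (ℕ.nonTrivial⇒n>1 b)) m≤n)

    -- Last digits are stripped from both numbers at once, by induction on a common bound. The
    -- shorter number is padded with leading zeros.
    digits-induction : ∀ {ℓ} (P : ℕ → ℕ → Set ℓ) → P 0 0 →
      (∀ (σ τ : Fin b) s t → P s t → P (toℕ σ ℕ.+ s ℕ.* b) (toℕ τ ℕ.+ t ℕ.* b)) →
      ∀ s t → P s t
    digits-induction P P₀ P⁺ s t = go (s ⊔ t) (ℕ.m≤m⊔n s t) (ℕ.m≤n⊔m s t)
      where
      go : ∀ n {s t} → s ≤ n → t ≤ n → P s t
      go zero    z≤n z≤n = P₀
      go (suc n) {s} {t} s≤n t≤n
        = ≡.subst₂ P (≡.sym (DivMod.property (s divMod b))) (≡.sym (DivMod.property (t divMod b)))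
            (P⁺ (s mod b) (t mod b) (s / b) (t / b) (go n (m/b≤ s≤n) (m/b≤ t≤n)))

    [d+m*b]%b : ∀ (d : Fin b) m → (toℕ d ℕ.+ m ℕ.* b) % b ≡ toℕ d
    [d+m*b]%b d m = ≡.trans ([m+kn]%n≡m%n (toℕ d) m b) (m<n⇒m%n≡m (Fin.toℕ<n d))

    [d+m*b]/b : ∀ (d : Fin b) m → (toℕ d ℕ.+ m ℕ.* b) / b ≡ m
    [d+m*b]/b d m = ≡.trans (+-distrib-/-∣ʳ (toℕ d) {d = b} (n∣m*n m))
      (≡.cong₂ ℕ._+_ (m<n⇒m/n≡0 (Fin.toℕ<n d)) (m*n/n≡m m b))

    -- Extension of a digit block to an autosimilar matrix

    -- n bounds the number of digits; any n ≥ s, t will do.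
    extendUpTo : ℕ → Matrix∞ → Matrix∞
    extendUpTo zero    A s t = 1#
    extendUpTo (suc n) A s t = A (s % b) (t % b) * extendUpTo n A (s / b) (t / b)

    extend : Matrix∞ → Matrix∞
    extend A s t = extendUpTo (s ⊔ t) A s t

    extendUpTo-0-0 : ∀ A → A 0 0 ≈ 1# → ∀ n → extendUpTo n A 0 0 ≈ 1#
    extendUpTo-0-0 A A₀ zero    = refl
    extendUpTo-0-0 A A₀ (suc n) = begin
      A (0 % b) (0 % b) * extendUpTo n A (0 / b) (0 / b)
        ≈⟨ *-cong (reflexive (≡.cong₂ A 0%b≡0 0%b≡0))
             (reflexive (≡.cong₂ (extendUpTo n A) (0/n≡0 b) (0/n≡0 b))) ⟩
      A 0 0 * extendUpTo n A 0 0
        ≈⟨ *-cong A₀ (extendUpTo-0-0 A A₀ n) ⟩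
      1# * 1#
        ≈⟨ *-identityʳ 1# ⟩
      1# ∎
      where
      0%b≡0 = m<n⇒m%n≡m (ℕ.>-nonZero⁻¹ b)

    -- Either bound suffices to exhaust the digits, and surplus steps only multiply by `A 0 0 ≈ 1#`.
    extendUpTo-irrelevant : ∀ A → A 0 0 ≈ 1# → ∀ m n {s t} →
      s ≤ m → t ≤ m → s ≤ n → t ≤ n → extendUpTo m A s t ≈ extendUpTo n A s t
    extendUpTo-irrelevant A A₀ zero    n    z≤n z≤n _ _ = sym (extendUpTo-0-0 A A₀ n)
    extendUpTo-irrelevant A A₀ (suc m) zero _ _ z≤n z≤n = extendUpTo-0-0 A A₀ (suc m)
    extendUpTo-irrelevant A A₀ (suc m) (suc n) s≤m t≤m s≤n t≤n =
      *-congˡ (extendUpTo-irrelevant A A₀ m n (m/b≤ s≤m) (m/b≤ t≤m) (m/b≤ s≤n) (m/b≤ t≤n))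

    extend-digit : ∀ A → A 0 0 ≈ 1# → ∀ (σ τ : Fin b) s t →
      extend A (toℕ σ ℕ.+ s ℕ.* b) (toℕ τ ℕ.+ t ℕ.* b) ≈ A (toℕ σ) (toℕ τ) * extend A s t
    extend-digit A A₀ σ τ s t = begin
      extendUpTo n A i j
        -- `n` may be 0, where no digit is read. Raising the bound by one exposes the last digit.
        ≈⟨ extendUpTo-irrelevant A A₀ n (suc n) i≤n j≤n (ℕ.m≤n⇒m≤1+n i≤n) (ℕ.m≤n⇒m≤1+n j≤n) ⟩
      A (i % b) (j % b) * extendUpTo n A (i / b) (j / b)
        ≈⟨ *-cong (reflexive (≡.cong₂ A ([d+m*b]%b σ s) ([d+m*b]%b τ t)))
             (reflexive (≡.cong₂ (extendUpTo n A) ([d+m*b]/b σ s) ([d+m*b]/b τ t))) ⟩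
      A (toℕ σ) (toℕ τ) * extendUpTo n A s t
        ≈⟨ *-congˡ (extendUpTo-irrelevant A A₀ n (s ⊔ t)
             (ℕ.≤-trans (m≤d+m*b σ s) i≤n) (ℕ.≤-trans (m≤d+m*b τ t) j≤n) (ℕ.m≤m⊔n s t) (ℕ.m≤n⊔m s t)) ⟩
      A (toℕ σ) (toℕ τ) * extend A s t ∎
      where
      i = toℕ σ ℕ.+ s ℕ.* b
      j = toℕ τ ℕ.+ t ℕ.* b
      n = i ⊔ j
      i≤n = ℕ.m≤m⊔n i j
      j≤n = ℕ.m≤n⊔m i j
      m≤d+m*b : ∀ (d : Fin b) m → m ≤ toℕ d ℕ.+ m ℕ.* b
      m≤d+m*b d m = ℕ.≤-trans (ℕ.m≤m*n m b) (ℕ.m≤n+m _ (toℕ d))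

    -- Expansions and uniqueness of autosimilar matrices

    -- Horner's rule, which links the sum of powers in the definition of an expansion to recursion
    -- on the last digit.
    fromExpansion-suc : ∀ {k} (σ : Fin (suc k) → Fin b) →
      fromExpansion b σ ≡ toℕ (σ zero) ℕ.+ fromExpansion b (σ ∘ suc) ℕ.* b
    fromExpansion-suc {k} σ = ≡.cong₂ ℕ._+_ (ℕ.*-identityʳ _)
      (≡.trans
        (ℕΣ.sum-cong-≋ {k} λ i → ≡.trans
          (≡.cong (toℕ (σ (suc i)) ℕ.*_) (ℕ.*-comm b _))
          (≡.sym (ℕ.*-assoc (toℕ (σ (suc i))) _ b)))
        (≡.sym (ℕΣ.*-distribʳ-sum {k} b (λ i → toℕ (σ (suc i)) ℕ.* b ℕ.^ toℕ i))))
      where module ℕΣ = SemiringSum ℕ.+-*-semiring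

    expansions : ∀ s t → ∃[ k ] ∃[ σ ] ∃[ τ ]
      (fromExpansion b {k} σ ≡ s × fromExpansion b {k} τ ≡ t)
    expansions = digits-induction _
      (0 , (λ ()) , (λ ()) , ≡.refl , ≡.refl)
      λ d e s t (k , σ , τ , σ≡s , τ≡t) →
        suc k , d ∷ σ , e ∷ τ ,
        ≡.trans (fromExpansion-suc (d ∷ σ)) (≡.cong (λ n → toℕ d ℕ.+ n ℕ.* b) σ≡s) ,
        ≡.trans (fromExpansion-suc (e ∷ τ)) (≡.cong (λ n → toℕ e ℕ.+ n ℕ.* b) τ≡t)

    product-cong : ∀ {n} {f g : Fin n → Carrier} → (∀ i → f i ≈ g i) → product f ≈ product g
    product-cong {zero}  f≈g = refl
    product-cong {suc n} f≈g = *-cong (f≈g zero) (product-cong (f≈g ∘ suc))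

    autosimilar-unique : ∀ {A B} → IsAutosimilar b A → IsAutosimilar b B →
      (∀ {i j} → i < b → j < b → A i j ≈ B i j) → A ≈∞ B
    autosimilar-unique {A} {B} (_ , A-auto) (_ , B-auto) A≈B s t
      with k , σ , τ , ≡.refl , ≡.refl ← expansions s t = begin
      A (fromExpansion b σ) (fromExpansion b τ)
        ≈⟨ A-auto σ τ ⟩
      product (λ i → A (toℕ (σ i)) (toℕ (τ i)))
        ≈⟨ product-cong {k} (λ i → A≈B (Fin.toℕ<n (σ i)) (Fin.toℕ<n (τ i))) ⟩
      product (λ i → B (toℕ (σ i)) (toℕ (τ i)))
        ≈⟨ B-auto σ τ ⟨
      B (fromExpansion b σ) (fromExpansion b τ) ∎

    extend-digits : ∀ A → A 0 0 ≈ 1# → ∀ (σ τ : Fin b) →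
      extend A (toℕ σ) (toℕ τ) ≈ A (toℕ σ) (toℕ τ)
    extend-digits A A₀ σ τ = begin
      extend A (toℕ σ) (toℕ τ)
        ≈⟨ reflexive (≡.cong₂ (extend A) (ℕ.+-identityʳ (toℕ σ)) (ℕ.+-identityʳ (toℕ τ))) ⟨
      extend A (toℕ σ ℕ.+ 0) (toℕ τ ℕ.+ 0)
        ≈⟨ extend-digit A A₀ σ τ 0 0 ⟩
      A (toℕ σ) (toℕ τ) * 1#
        ≈⟨ *-identityʳ _ ⟩
      A (toℕ σ) (toℕ τ) ∎

    extend-autosimilar : ∀ A → A 0 0 ≈ 1# → IsAutosimilar b (extend A)
    extend-autosimilar A A₀ = refl , λ σ τ → trans (expand σ τ)
        (product-cong λ i → sym (extend-digits A A₀ (σ i) (τ i)))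
      where
      expand : ∀ {k} (σ τ : Fin k → Fin b) →
        extend A (fromExpansion b σ) (fromExpansion b τ) ≈ product (λ i → A (toℕ (σ i)) (toℕ (τ i)))
      expand {zero}  σ τ = refl
      expand {suc k} σ τ = begin
        extend A (fromExpansion b σ) (fromExpansion b τ)
          ≈⟨ reflexive (≡.cong₂ (extend A) (fromExpansion-suc σ) (fromExpansion-suc τ)) ⟩
        _ ≈⟨ extend-digit A A₀ (σ zero) (τ zero) (fromExpansion b (σ ∘ suc)) (fromExpansion b (τ ∘ suc)) ⟩
        _ ≈⟨ *-congˡ (expand (σ ∘ suc) (τ ∘ suc)) ⟩
        product (λ i → A (toℕ (σ i)) (toℕ (τ i))) ∎

    -- Triangular and diagonal shape of the extension

    -- If two numbers are related, then so are their digits at some position, and the corresponding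
    -- factor kills the product. The relations of interest are `<`, `>` and `≢`.
    extend-≈0 : ∀ {ℓ} (_∼_ : Rel ℕ ℓ) → ¬ 0 ∼ 0 →
      (∀ (σ τ : Fin b) s t → (toℕ σ ℕ.+ s ℕ.* b) ∼ (toℕ τ ℕ.+ t ℕ.* b) → toℕ σ ∼ toℕ τ ⊎ s ∼ t) →
      ∀ A → A 0 0 ≈ 1# → (∀ i j → i ∼ j → A i j ≈ 0#) → ∀ i j → i ∼ j → extend A i j ≈ 0#
    extend-≈0 _∼_ 0≁0 split A A₀ A≈0 = digits-induction _
      (λ 0∼0 → contradiction 0∼0 0≁0)
      λ σ τ s t ih i∼j → trans (extend-digit A A₀ σ τ s t) (case-≈0 ih (split σ τ s t i∼j))
      where
      case-≈0 : ∀ {i j s t} → (s ∼ t → extend A s t ≈ 0#) → i ∼ j ⊎ s ∼ t → A i j * extend A s t ≈ 0#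
      case-≈0 _  (inj₁ i∼j) = trans (*-congʳ (A≈0 _ _ i∼j)) (zeroˡ _)
      case-≈0 ih (inj₂ s∼t) = trans (*-congˡ (ih s∼t)) (zeroʳ _)

    split-< : ∀ (σ τ : Fin b) s t → toℕ σ ℕ.+ s ℕ.* b < toℕ τ ℕ.+ t ℕ.* b → toℕ σ < toℕ τ ⊎ s < t
    split-< σ τ s t i<j with ℕ.<-≤-connex s t | ℕ.<-≤-connex (toℕ σ) (toℕ τ)
    ... | inj₁ s<t | _        = inj₂ s<t
    ... | inj₂ _   | inj₁ σ<τ = inj₁ σ<τ
    ... | inj₂ t≤s | inj₂ τ≤σ =
      contradiction i<j (ℕ.≤⇒≯ (ℕ.+-mono-≤ τ≤σ (ℕ.*-monoˡ-≤ b t≤s)))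

    split-≢ : ∀ (σ τ : Fin b) s t → toℕ σ ℕ.+ s ℕ.* b ≢ toℕ τ ℕ.+ t ℕ.* b → toℕ σ ≢ toℕ τ ⊎ s ≢ t
    split-≢ σ τ s t i≢j with toℕ σ ℕ.≟ toℕ τ
    ... | no  σ≢τ = inj₁ σ≢τ
    ... | yes σ≡τ = inj₂ λ s≡t → i≢j (≡.cong₂ (λ d m → d ℕ.+ m ℕ.* b) σ≡τ s≡t)

    extend-unit : ∀ A → (∀ i → A i i ≈ 1#) → ∀ i → extend A i i ≈ 1#
    extend-unit A A-unit i = go (i ⊔ i) i
      where
      go : ∀ n i → extendUpTo n A i i ≈ 1#
      go zero    i = refl
      go (suc n) i = trans (*-cong (A-unit (i % b)) (go n (i / b))) (*-identityʳ 1#)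

    extend-lower : ∀ A → A 0 0 ≈ 1# → (∀ i j → i < j → A i j ≈ 0#) → ∀ i j → i < j → extend A i j ≈ 0#
    extend-lower = extend-≈0 _<_ (ℕ.<-irrefl ≡.refl) split-<

    -- Compatibility of the extension with products

    extend-⊗ : ∀ A B → A 0 0 ≈ 1# → B 0 0 ≈ 1# → (∀ i j → i < j → A i j ≈ 0#) →
      extend A ⊗ extend B ≈∞ extend (A ⊗ B)
    extend-⊗ A B A₀ B₀ A-lower = digits-induction _ base step
      where
      AB₀ : (A ⊗ B) 0 0 ≈ 1#
      AB₀ = trans (+-identityʳ _) (trans (*-cong A₀ B₀) (*-identityʳ 1#))

      base = trans (+-identityʳ _) (*-identityʳ 1#)

      α = extend A
      β = extend B

      step : ∀ (σ τ : Fin b) s t → (α ⊗ β) s t ≈ extend (A ⊗ B) s t →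
        (α ⊗ β) (toℕ σ ℕ.+ s ℕ.* b) (toℕ τ ℕ.+ t ℕ.* b)
          ≈ extend (A ⊗ B) (toℕ σ ℕ.+ s ℕ.* b) (toℕ τ ℕ.+ t ℕ.* b)
      step σ τ s t ih = begin
        Σ[0, suc i ⟩ (λ k → α i k * β k j)
          -- The sum stops at `k = i`, possibly in the middle of a block. It is padded to `suc s`
          -- full blocks with terms that vanish above the diagonal, so that the digit and the
          -- quotient of `k` range independently.
          ≈⟨ Σ-pad (λ k → α i k * β k j) (ℕ.+-monoˡ-≤ (s ℕ.* b) (Fin.toℕ<n σ))
               (λ k i<k → trans (*-congʳ (extend-lower A A₀ A-lower i k i<k)) (zeroˡ _)) ⟩
        Σ[0, suc s ℕ.* b ⟩ (λ k → α i k * β k j)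
          ≈⟨ Σ-blocks (suc s) b (λ k → α i k * β k j) ⟩
        Σ[0, suc s ⟩ (λ q → Σ[0, b ⟩ (λ r → α i (r ℕ.+ q ℕ.* b) * β (r ℕ.+ q ℕ.* b) j))
          ≈⟨ Σ-cong (suc s) (λ q → sum-cong-≋ {b} (λ ρ → *-cong
               (extend-digit A A₀ σ ρ s q) (extend-digit B B₀ ρ τ q t))) ⟩
        Σ[0, suc s ⟩ (λ q → Σ[0, b ⟩ (λ r → A σ′ r * α s q * (B r τ′ * β q t)))
          ≈⟨ Σ-cong (suc s) (λ q → trans
               (Σ-cong b (λ r → solve 4 (λ w x y z → w :* x :* (y :* z) := w :* y :* (x :* z))
                  refl (A σ′ r) (α s q) (B r τ′) (β q t)))
               (sym (*-distribʳ-sum {b} (α s q * β q t) (λ r → A σ′ (toℕ r) * B (toℕ r) τ′)))) ⟩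
        Σ[0, suc s ⟩ (λ q → Σ[0, b ⟩ (λ r → A σ′ r * B r τ′) * (α s q * β q t))
          ≈⟨ *-distribˡ-sum {suc s} (Σ[0, b ⟩ (λ r → A σ′ r * B r τ′)) (λ q → α s (toℕ q) * β (toℕ q) t) ⟨
        Σ[0, b ⟩ (λ r → A σ′ r * B r τ′) * (α ⊗ β) s t
          -- Conversely, the full sum over digits is cut back to `r ≤ σ′`, the range used by `⊗`,
          -- because `A` is lower-triangular.
          ≈⟨ *-cong
               (sym (Σ-pad (λ r → A σ′ r * B r τ′) (Fin.toℕ<n σ)
                 (λ r σ<r → trans (*-congʳ (A-lower σ′ r σ<r)) (zeroˡ _))))
               ih ⟩
        (A ⊗ B) σ′ τ′ * extend (A ⊗ B) s t
          ≈⟨ extend-digit (A ⊗ B) AB₀ σ τ s t ⟨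
        extend (A ⊗ B) i j ∎
        where
        σ′ = toℕ σ
        τ′ = toℕ τ
        i = σ′ ℕ.+ s ℕ.* b
        j = τ′ ℕ.+ t ℕ.* b

    ⊗-lower : ∀ A B → (∀ i j → i < j → B i j ≈ 0#) → ∀ i j → i < j → (A ⊗ B) i j ≈ 0#
    ⊗-lower A B B-lower i j i<j = sum-≈0 {suc i} (λ k → A i (toℕ k) * B (toℕ k) j) λ k →
      trans (*-congˡ (B-lower (toℕ k) j (ℕ.≤-<-trans (ℕ.≤-pred (Fin.toℕ<n k)) i<j))) (zeroʳ (A i (toℕ k)))

    ⊗-congʳ : ∀ {A B} C → A ≈∞ B → A ⊗ C ≈∞ B ⊗ C
    ⊗-congʳ C A≈B i j = sum-cong-≋ {suc i} λ k → *-congʳ {C (toℕ k) j} (A≈B i (toℕ k))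

    -- Factorization of an autosimilar matrix

    -- Non-degeneracy starts at size 2. The minor of size 1 is the corner entry, which
    -- autosimilarity sets to 1.
    leading-minors#0 : ∀ M → M 0 0 ≈ 1# → IsNonDegenerate b M →
      ∀ m → m < b → det (leading M (suc m)) # 0#
    leading-minors#0 M M₀ _ zero _ = #-congʳ (sym (trans (det-leading₁ M) M₀)) 1#0
    leading-minors#0 M _ M-nondegenerate (suc m) m<b = M-nondegenerate (suc (suc m)) (s≤s (s≤s z≤n)) m<b

    autosimilar-LDU : (M : Matrix∞) → IsAutosimilar b M → IsNonDegenerate b M →
      ∃[ L ] ∃[ D ] ∃[ U ]
        ( M ≈∞ L ⊗ D ⊗ U
        × (IsAutosimilar b L × IsUnipotentLowerTriangular L)
        × (IsAutosimilar b D × IsDiagonal D)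
        × (IsAutosimilar b U × IsUnipotentUpperTriangular U) )
    autosimilar-LDU M M-auto@(M₀ , _) M-nondegenerate
      with L , D , U , M≈LDU , (L-lower , L-unit) , D-diagonal , (U-upper , U-unit) ←
        leading-LDU b M (leading-minors#0 M M₀ M-nondegenerate)
      = extend L , extend D , extend U , factorization ,
        (extend-autosimilar L L₀ , extend-lower L L₀ L-lower , extend-unit L L-unit) ,
        (extend-autosimilar D D₀ ,
          extend-≈0 _≢_ (λ 0≢0 → 0≢0 ≡.refl) split-≢ D D₀ D-diagonal) ,
        (extend-autosimilar U U₀ ,
          extend-≈0 ℕ._>_ (ℕ.<-irrefl ≡.refl) (λ σ τ s t → split-< τ σ t s) U U₀ U-upper ,
          extend-unit U U-unit)
      where
      L₀ = L-unit 0
      U₀ = U-unit 0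
      -- Extension requires corner entry 1. For `L` and `U` this is unipotence; for `D` it follows
      -- from `M 0 0 ≈ 1#`, since the corner of the product is that of `D`.
      LD₀≈D₀ : (L ⊗ D) 0 0 ≈ D 0 0
      LD₀≈D₀ = trans (+-identityʳ _) (trans (*-congʳ L₀) (*-identityˡ _))
      LDU₀≈D₀ : (L ⊗ D ⊗ U) 0 0 ≈ D 0 0
      LDU₀≈D₀ = trans (+-identityʳ _) (trans (*-cong LD₀≈D₀ U₀) (*-identityʳ _))
      LDU₀ : (L ⊗ D ⊗ U) 0 0 ≈ 1#
      LDU₀ = trans (sym (M≈LDU (ℕ.>-nonZero⁻¹ b) (ℕ.>-nonZero⁻¹ b))) M₀
      D₀ : D 0 0 ≈ 1#
      D₀ = trans (sym LDU₀≈D₀) LDU₀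

      factorization : M ≈∞ extend L ⊗ extend D ⊗ extend U
      factorization s t = begin
        M s t
          ≈⟨ autosimilar-unique M-auto (extend-autosimilar (L ⊗ D ⊗ U) LDU₀) digits s t ⟩
        extend (L ⊗ D ⊗ U) s t
          -- The left factor must be lower-triangular, and `L ⊗ D` is, because `D` is diagonal.
          ≈⟨ extend-⊗ (L ⊗ D) U (trans LD₀≈D₀ D₀) U₀
               (⊗-lower L D (λ i j i<j → D-diagonal i j (ℕ.<⇒≢ i<j))) s t ⟨
        (extend (L ⊗ D) ⊗ extend U) s t
          ≈⟨ ⊗-congʳ (extend U) (extend-⊗ L D L₀ D₀ L-lower) s t ⟨
        (extend L ⊗ extend D ⊗ extend U) s t ∎
        where
        digits : ∀ {i j} → i < b → j < b → M i j ≈ extend (L ⊗ D ⊗ U) i j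
        digits {i} {j} i<b j<b = trans (M≈LDU i<b j<b)
          (≡.subst₂ (λ i j → (L ⊗ D ⊗ U) i j ≈ extend (L ⊗ D ⊗ U) i j)
            (Fin.toℕ-fromℕ< i<b) (Fin.toℕ-fromℕ< j<b)
            (sym (extend-digits (L ⊗ D ⊗ U) LDU₀ (fromℕ< i<b) (fromℕ< j<b))))

theorem2p1 : ∀ {c ℓ₁ ℓ₂} (K : HeytingField c ℓ₁ ℓ₂) →
    let open InfiniteMatrices K in
    (b : ℕ) → 2 ≤ b →
    (M : Matrix∞) → IsAutosimilar b M → IsNonDegenerate b M →
    ∃[ L ] ∃[ D ] ∃[ U ]
    ( M ≈∞ L ⊗ D ⊗ U
    × (IsAutosimilar b L × IsUnipotentLowerTriangular L)
    × (IsAutosimilar b D × IsDiagonal D)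
    × (IsAutosimilar b U × IsUnipotentUpperTriangular U) )
theorem2p1 K b 2≤b = autosimilar-LDU
  where open Factorization.Base K b {{ℕ.n>1⇒nonTrivial 2≤b}}
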